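{- Let $m,n\ge1$ and let $T\subseteq\{1,\dots,m\}\times\{1,\dots,n\}$. Then $T$ is an hv-convex polyomino if and only if its complement $\overline{T}$ in the grid $\{1,\dots,m\}\times\{1,\dots,n\}$ can be written as $\overline{T}=A\cup B\cup C\cup D$, where $A,B,C,D$ are pairwise disjoint corner regions (upper-left, upper-right, lower-left and lower-right, respectively) such that (i) $(i-1,j-1)\in A$ implies $(i,j)\notin D$, and (ii) $(i-1,j+1)\in B$ implies $(i,j)\notin C$.
   Context: Cells of the $m\times n$ grid are pairs $(i,j)$ with row index $i\in\{1,\dots,m\}$ (row 1 at the top) and column index $j\in\{1,\dots,n\}$ (column 1 at the left). A set $T$ of cells is a polyomino if the graph whose vertices are the cells of $T$, with $(i,j)$ and $(i',j')$ adjacent iff $|i-i'|+|j-j'|\le 1$, is connected (the empty set is regarded as connected). $T$ is h-convex if $(i,k),(i,l)\in T$ implies $(i,j)\in T$ for all $k\le j\le l$; v-convexity is defined analogously for columns; $T$ is hv-convex if it is both. Corner regions are (possibly empty) sets of cells of the grid. $A$ is an upper-left corner region if, for every cell $(i,j)$ of the grid, $(i+1,j)\in A$ or $(i,j+1)\in A$ implies $(i,j)\in A$. Analogously: $B$ is an upper-right corner region if $(i+1,j)\in B$ or $(i,j-1)\in B$ implies $(i,j)\in B$; $C$ is a lower-left corner region if $(i-1,j)\in C$ or $(i,j+1)\in C$ implies $(i,j)\in C$; $D$ is a lower-right corner region if $(i-1,j)\in D$ or $(i,j-1)\in D$ implies $(i,j)\in D$ (in each case for every cell $(i,j)$ of the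 grid). -}

module Defs where

open import Data.Bool.Base using (Bool; T)
open import Data.Fin.Base using (Fin; toℕ; _≤_)
open import Data.Nat.Base as ℕ using (ℕ; suc; _+_; ∣_-_∣)
open import Data.Product.Base using (∃; _×_; _,_; proj₁)
open import Data.Sum.Base using (_⊎_)
open import Function.Base using (_on_)
open import Level using (0ℓ)
open import Relation.Binary.Construct.Closure.ReflexiveTransitive using (Star)
open import Relation.Binary.PropositionalEquality.Core using (_≡_)
open import Relation.Unary using (Pred; _∈_; _∉_)

private
  variable
    m n : ℕ

-- Row and column indices start at 0: row 0 is at the top, column 0 at the left.
Cell : ℕ → ℕ → Set
Cell m n = Fin m × Fin n

-- Subsets of the finite grid are given by their characteristic functions, so
-- that membership is decidable.
CellSet : ℕ → ℕ → Set
CellSet m n = Cell m n → Bool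

⟦_⟧ : CellSet m n → Pred (Cell m n) 0ℓ
⟦ S ⟧ p = T (S p)

-- The bound is ≤ 1, not ≡ 1, so every cell is adjacent to itself (harmless loops).
Adjacent : Cell m n → Cell m n → Set
Adjacent (i , j) (i′ , j′) =
  ∣ toℕ i - toℕ i′ ∣ + ∣ toℕ j - toℕ j′ ∣ ℕ.≤ 1

CellOf : CellSet m n → Set
CellOf S = ∃ λ p → p ∈ ⟦ S ⟧

-- Paths have all their vertices in S; the empty set is connected.
Polyomino : CellSet m n → Set
Polyomino S = (u v : CellOf S) → Star (Adjacent on proj₁) u v

HConvex : CellSet m n → Set
HConvex {m} {n} S = (i : Fin m) (k j l : Fin n) →
  (i , k) ∈ ⟦ S ⟧ → (i , l) ∈ ⟦ S ⟧ → k ≤ j → j ≤ l → (i , j) ∈ ⟦ S ⟧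

VConvex : CellSet m n → Set
VConvex {m} {n} S = (k i l : Fin m) (j : Fin n) →
  (k , j) ∈ ⟦ S ⟧ → (l , j) ∈ ⟦ S ⟧ → k ≤ i → i ≤ l → (i , j) ∈ ⟦ S ⟧

HVConvex : CellSet m n → Set
HVConvex S = HConvex S × VConvex S

-- i ⋖ i′ says i′ = i + 1.  Shifted cells such as (i + 1 , j) may lie outside
-- the grid, in which case they belong to no set; hence the relational form.
infix 4 _⋖_

_⋖_ : Fin n → Fin n → Set
i ⋖ i′ = toℕ i′ ≡ suc (toℕ i)

below∈ above∈ right∈ left∈ : CellSet m n → Pred (Cell m n) 0ℓ
below∈ S (i , j) = ∃ λ i′ → i ⋖ i′ × (i′ , j) ∈ ⟦ S ⟧
above∈ S (i , j) = ∃ λ i′ → i′ ⋖ i × (i′ , j) ∈ ⟦ S ⟧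
right∈ S (i , j) = ∃ λ j′ → j ⋖ j′ × (i , j′) ∈ ⟦ S ⟧
left∈  S (i , j) = ∃ λ j′ → j′ ⋖ j × (i , j′) ∈ ⟦ S ⟧

UpperLeft UpperRight LowerLeft LowerRight : CellSet m n → Set
UpperLeft  A = ∀ p → p ∈ below∈ A ⊎ p ∈ right∈ A → p ∈ ⟦ A ⟧
UpperRight B = ∀ p → p ∈ below∈ B ⊎ p ∈ left∈ B  → p ∈ ⟦ B ⟧
LowerLeft  C = ∀ p → p ∈ above∈ C ⊎ p ∈ right∈ C → p ∈ ⟦ C ⟧
LowerRight D = ∀ p → p ∈ above∈ D ⊎ p ∈ left∈ D  → p ∈ ⟦ D ⟧

{-# OPTIONS --safe #-}
-- A path in T meets only one of two diagonally opposite quadrants when the rays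
-- bounding the first miss T, so every cell outside a non-empty hv-convex
-- polyomino T is the apex of a closed quadrant missing T.  Collecting the apexes
-- by direction gives corner regions that overlap only outside the bounding box
-- of T; there they are separated at the columns t, b of a topmost and a
-- bottommost cell and the rows l, r of a leftmost and a rightmost cell.  The
-- separating lines are shared out as in a pinwheel (column t to B, row r to D,
-- column b to C, row l to A): mirror-symmetric choices violate (i) or (ii) when
-- T is a single cell.
--
-- Conversely, going from one cell of T to another by steps towards the target,
-- one gets stuck only if both next cells lie in diagonally opposite corner
-- regions, which (i) and (ii) forbid.
module Submission where

open import Defs
open import Data.Bool.Base using (true; false)
open import Data.Bool.Properties using (T?)
import Data.Empty as Empty
open import Data.Fin.Base as Fin using (Fin; toℕ; zero; suc)
open import Data.Fin.Induction using (<-wellFounded; >-wellFounded)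
open import Data.Fin.Properties
  using (any?; ≤-total; ≤-antisym; ≤-refl; ≤-trans; _≤?_; _<?_; toℕ-injective)
open import Data.Nat.Base using (ℕ; _≤_; z≤n; s≤s; s≤s⁻¹; ∣_-_∣)
import Data.Nat.Properties as ℕ
open import Data.Product.Base using (∃; _×_; _,_; ∃-syntax; proj₁; proj₂)
open import Data.Sum.Base as Sum using (_⊎_; inj₁; inj₂; [_,_]′)
open import Data.Unit.Base using (tt)
open import Function.Base using (_∘_; _on_; case_of_; flip; id)
open import Function.Bundles using (_⇔_; mk⇔)
open import Induction.WellFounded using (WellFounded; Acc; acc)
open import Level using (0ℓ)
open import Relation.Binary.Core using (Rel)
open import Relation.Binary.Definitions as B using (Total; Antisymmetric)
open import Relation.Binary.Construct.Closure.ReflexiveTransitive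
  using (Star; ε; _◅_; fold; gmap; reverse)
open import Relation.Binary.PropositionalEquality using (_≡_; refl; sym; cong)
open import Relation.Nullary using (¬_; yes; no; contradiction)
open import Relation.Nullary.Decidable
  using (⌊_⌋; toWitness; fromWitness; ¬?; _×-dec_; decidable-stable)
open import Relation.Unary using (Pred; Decidable; _∈_; _∉_; ∁; _∪_; _≐_; _⊥_)

private
  variable
    m n : ℕ
    S : CellSet m n

adjacent⇒aligned : {i i′ : Fin m} {j j′ : Fin n} →
  Adjacent (i , j) (i′ , j′) → i ≡ i′ ⊎ j ≡ j′
adjacent⇒aligned {i = i} {i′} {j} {j′} adj
  with ∣ toℕ i - toℕ i′ ∣ in eqᵢ | ∣ toℕ j - toℕ j′ ∣ in eqⱼ
... | 0         | _ = inj₁ (toℕ-injective (ℕ.∣m-n∣≡0⇒m≡n eqᵢ))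
... | 1         | 0 = inj₂ (toℕ-injective (ℕ.∣m-n∣≡0⇒m≡n eqⱼ))
adjacent⇒aligned (s≤s ()) | 1 | ℕ.suc _
adjacent⇒aligned (s≤s ()) | ℕ.suc (ℕ.suc _) | _

adjacent-sym : (p q : Cell m n) → Adjacent p q → Adjacent q p
adjacent-sym (i , j) (i′ , j′) adj
  rewrite ℕ.∣-∣-comm (toℕ i′) (toℕ i) | ℕ.∣-∣-comm (toℕ j′) (toℕ j) = adj

loop : (p : Cell m n) → Adjacent p p
loop (i , j) rewrite ℕ.∣n-n∣≡0 (toℕ i) | ℕ.∣n-n∣≡0 (toℕ j) = z≤n

∣n-1+n∣≡1 : ∀ k → ∣ k - ℕ.suc k ∣ ≡ 1
∣n-1+n∣≡1 0         = refl
∣n-1+n∣≡1 (ℕ.suc k) = ∣n-1+n∣≡1 k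

vertical-adjacent : {i i′ : Fin m} {j : Fin n} → i ⋖ i′ → Adjacent (i , j) (i′ , j)
vertical-adjacent {i = i} {j = j} e
  rewrite e | ∣n-1+n∣≡1 (toℕ i) | ℕ.∣n-n∣≡0 (toℕ j) = s≤s z≤n

horizontal-adjacent : {i : Fin m} {j j′ : Fin n} → j ⋖ j′ → Adjacent (i , j) (i , j′)
horizontal-adjacent {i = i} {j = j} e
  rewrite e | ∣n-1+n∣≡1 (toℕ j) | ℕ.∣n-n∣≡0 (toℕ i) = s≤s z≤n

invariant : (P : Pred (Cell m n) 0ℓ) → Polyomino S →
  (∀ {i j j′} → (i , j) ∈ ⟦ S ⟧ → (i , j′) ∈ ⟦ S ⟧ → P (i , j) → P (i , j′)) →
  (∀ {i i′ j} → (i , j) ∈ ⟦ S ⟧ → (i′ , j) ∈ ⟦ S ⟧ → P (i , j) → P (i′ , j)) →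
  ∀ {p q} → p ∈ ⟦ S ⟧ → q ∈ ⟦ S ⟧ → P p → P q
invariant {S = S} P conn hstep vstep p∈ q∈ =
  fold (λ u v → P (proj₁ u) → P (proj₁ v)) (λ {u} {v} adj k → k ∘ step u v adj) id
       (conn (_ , p∈) (_ , q∈))
  where
  step : (u v : CellOf S) → Adjacent (proj₁ u) (proj₁ v) → P (proj₁ u) → P (proj₁ v)
  step ((i , j) , u∈) ((i′ , j′) , v∈) adj with adjacent⇒aligned {i = i} {i′} {j} {j′} adj
  ... | inj₁ refl = hstep u∈ v∈
  ... | inj₂ refl = vstep u∈ v∈

row-invariant : (P : Pred (Fin m) 0ℓ) (Q : Pred (Fin n) 0ℓ) → Polyomino S →
  (∀ {i j} → (i , j) ∈ ⟦ S ⟧ → P i → Q j) → (∀ {i j} → (i , j) ∈ ⟦ S ⟧ → Q j → P i) →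
  ∀ {i j i′ j′} → (i , j) ∈ ⟦ S ⟧ → (i′ , j′) ∈ ⟦ S ⟧ → P i → P i′
row-invariant P Q conn P⇒Q Q⇒P =
  invariant (P ∘ proj₁) conn (λ _ _ Pi → Pi) (λ p∈ q∈ Pi → Q⇒P q∈ (P⇒Q p∈ Pi))

Meets : (S : CellSet m n) → Rel (Fin m) 0ℓ → Rel (Fin n) 0ℓ → Pred (Cell m n) 0ℓ
Meets S R C (i , j) = ∃ λ a → ∃ λ b → (a , b) ∈ ⟦ S ⟧ × R a i × C b j

meets? : (S : CellSet m n) {R : Rel (Fin m) 0ℓ} {C : Rel (Fin n) 0ℓ} →
  B.Decidable R → B.Decidable C → Decidable (Meets S R C)
meets? S R? C? (i , j) =
  any? λ a → any? λ b → T? (S (a , b)) ×-dec R? a i ×-dec C? b j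

-- If the two closed rays bounding a quadrant at (i , j) miss S, a path in S
-- cannot leave the quadrant.
quadrant-closed : {R : Rel (Fin m) 0ℓ} {C : Rel (Fin n) 0ℓ} {i : Fin m} {j : Fin n} →
  Polyomino S → Total R → Total C →
  (∀ {i k j l} → (i , k) ∈ ⟦ S ⟧ → (i , l) ∈ ⟦ S ⟧ → C k j → C j l → (i , j) ∈ ⟦ S ⟧) →
  (∀ {k i l j} → (k , j) ∈ ⟦ S ⟧ → (l , j) ∈ ⟦ S ⟧ → R k i → R i l → (i , j) ∈ ⟦ S ⟧) →
  (∀ {a} → R a i → (a , j) ∉ ⟦ S ⟧) → (∀ {b} → C b j → (i , b) ∉ ⟦ S ⟧) →
  ∀ {p q} → p ∈ ⟦ S ⟧ → q ∈ ⟦ S ⟧ →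
  R (proj₁ p) i × C (proj₂ p) j → R (proj₁ q) i × C (proj₂ q) j
quadrant-closed {S = S} {R} {C} {i} {j} conn R-total C-total hconv vconv vfree hfree =
  invariant (λ p → R (proj₁ p) i × C (proj₂ p) j) conn hstep vstep
  where
  hstep : ∀ {a b b′} → (a , b) ∈ ⟦ S ⟧ → (a , b′) ∈ ⟦ S ⟧ → R a i × C b j → R a i × C b′ j
  hstep {b′ = b′} p∈ q∈ (Rai , Cbj) with C-total b′ j
  ... | inj₁ Cb′j = Rai , Cb′j
  ... | inj₂ Cjb′ = contradiction (hconv p∈ q∈ Cbj Cjb′) (vfree Rai)

  vstep : ∀ {a a′ b} → (a , b) ∈ ⟦ S ⟧ → (a′ , b) ∈ ⟦ S ⟧ → R a i × C b j → R a′ i × C b j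
  vstep {a′ = a′} p∈ q∈ (Rai , Cbj) with R-total a′ i
  ... | inj₁ Ra′i = Ra′i , Cbj
  ... | inj₂ Ria′ = contradiction (vconv p∈ q∈ Rai Ria′) (hfree Cbj)

opposite-quadrants : {R : Rel (Fin m) 0ℓ} {C : Rel (Fin n) 0ℓ} {i : Fin m} {j : Fin n} →
  Polyomino S → Total R → Total C → Antisymmetric _≡_ R → Antisymmetric _≡_ C →
  (∀ {i k j l} → (i , k) ∈ ⟦ S ⟧ → (i , l) ∈ ⟦ S ⟧ → C k j → C j l → (i , j) ∈ ⟦ S ⟧) →
  (∀ {k i l j} → (k , j) ∈ ⟦ S ⟧ → (l , j) ∈ ⟦ S ⟧ → R k i → R i l → (i , j) ∈ ⟦ S ⟧) →
  (∀ {a} → R a i → (a , j) ∉ ⟦ S ⟧) → (∀ {b} → C b j → (i , b) ∉ ⟦ S ⟧) →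
  Meets S R C (i , j) → ¬ Meets S (flip R) (flip C) (i , j)
opposite-quadrants conn R-total C-total R-antisym C-antisym hconv vconv vfree hfree
  (_ , _ , p∈ , Rai , Cbj) (_ , _ , q∈ , Ria′ , Cjb′)
  with quadrant-closed conn R-total C-total hconv vconv vfree hfree p∈ q∈ (Rai , Cbj)
... | Ra′i , Cb′j with refl ← R-antisym Ra′i Ria′ | refl ← C-antisym Cb′j Cjb′ = hfree Cb′j q∈

free-quadrant : Polyomino S → HVConvex S → ∀ {p} → p ∉ ⟦ S ⟧ →
  Meets S Fin._≤_ Fin._≤_ p → Meets S Fin._≤_ Fin._≥_ p →
  Meets S Fin._≥_ Fin._≤_ p → ¬ Meets S Fin._≥_ Fin._≥_ p
free-quadrant {S = S} conn (hconv , vconv) {i , j} p∉ meetsA meetsB meetsC meetsD = go vrays hrays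
  where
  hc : ∀ {i k j l} → (i , k) ∈ ⟦ S ⟧ → (i , l) ∈ ⟦ S ⟧ → k Fin.≤ j → j Fin.≤ l → (i , j) ∈ ⟦ S ⟧
  hc = hconv _ _ _ _

  vc : ∀ {k i l j} → (k , j) ∈ ⟦ S ⟧ → (l , j) ∈ ⟦ S ⟧ → k Fin.≤ i → i Fin.≤ l → (i , j) ∈ ⟦ S ⟧
  vc = vconv _ _ _ _

  hrays : (∀ {b} → b Fin.≤ j → (i , b) ∉ ⟦ S ⟧) ⊎ (∀ {b} → b Fin.≥ j → (i , b) ∉ ⟦ S ⟧)
  hrays with any? (λ b → b ≤? j ×-dec T? (S (i , b)))
  ... | yes (_ , b≤j , b∈) = inj₂ λ j≤b′ b′∈ → p∉ (hc b∈ b′∈ b≤j j≤b′)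
  ... | no ¬left           = inj₁ λ b≤j b∈ → ¬left (_ , b≤j , b∈)

  vrays : (∀ {a} → a Fin.≤ i → (a , j) ∉ ⟦ S ⟧) ⊎ (∀ {a} → a Fin.≥ i → (a , j) ∉ ⟦ S ⟧)
  vrays with any? (λ a → a ≤? i ×-dec T? (S (a , j)))
  ... | yes (_ , a≤i , a∈) = inj₂ λ i≤a′ a′∈ → p∉ (vc a∈ a′∈ a≤i i≤a′)
  ... | no ¬up             = inj₁ λ a≤i a∈ → ¬up (_ , a≤i , a∈)

  go : (∀ {a} → a Fin.≤ i → (a , j) ∉ ⟦ S ⟧) ⊎ (∀ {a} → a Fin.≥ i → (a , j) ∉ ⟦ S ⟧) →
       (∀ {b} → b Fin.≤ j → (i , b) ∉ ⟦ S ⟧) ⊎ (∀ {b} → b Fin.≥ j → (i , b) ∉ ⟦ S ⟧) → Empty.⊥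
  go (inj₁ up) (inj₁ left) =
    opposite-quadrants conn ≤-total ≤-total ≤-antisym ≤-antisym hc vc up left meetsA meetsD
  go (inj₁ up) (inj₂ right) =
    opposite-quadrants conn ≤-total (flip ≤-total) ≤-antisym (flip ≤-antisym)
      (λ k∈ l∈ j≤k l≤j → hc l∈ k∈ l≤j j≤k) vc up right meetsB meetsC
  go (inj₂ down) (inj₁ left) =
    opposite-quadrants conn (flip ≤-total) ≤-total (flip ≤-antisym) ≤-antisym
      hc (λ k∈ l∈ i≤k l≤i → vc l∈ k∈ l≤i i≤k) down left meetsC meetsB
  go (inj₂ down) (inj₂ right) =
    opposite-quadrants conn (flip ≤-total) (flip ≤-total) (flip ≤-antisym) (flip ≤-antisym)
      (λ k∈ l∈ j≤k l≤j → hc l∈ k∈ l≤j j≤k) (λ k∈ l∈ i≤k l≤i → vc l∈ k∈ l≤i i≤k)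
      down right meetsD meetsA

record Extremes (S : CellSet m n) : Set where
  field
    {top bottom l r} : Fin m
    {left right t b} : Fin n
    topmost    : (top , t) ∈ ⟦ S ⟧
    bottommost : (bottom , b) ∈ ⟦ S ⟧
    leftmost   : (l , left) ∈ ⟦ S ⟧
    rightmost  : (r , right) ∈ ⟦ S ⟧
    top≤    : ∀ {i j} → (i , j) ∈ ⟦ S ⟧ → top Fin.≤ i
    ≤bottom : ∀ {i j} → (i , j) ∈ ⟦ S ⟧ → i Fin.≤ bottom
    left≤   : ∀ {i j} → (i , j) ∈ ⟦ S ⟧ → left Fin.≤ j
    ≤right  : ∀ {i j} → (i , j) ∈ ⟦ S ⟧ → j Fin.≤ right

minimal : {I : Set} {_≺_ : Rel I 0ℓ} → WellFounded _≺_ → B.Decidable _≺_ →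
  (f : Cell m n → I) → CellOf S → ∃ λ p → p ∈ ⟦ S ⟧ × (∀ {q} → q ∈ ⟦ S ⟧ → ¬ f q ≺ f p)
minimal {S = S} {_≺_ = _≺_} wf _≺?_ f (p₀ , p₀∈) = go p₀ p₀∈ (wf (f p₀))
  where
  go : ∀ p → p ∈ ⟦ S ⟧ → Acc _≺_ (f p) →
       ∃ λ p → p ∈ ⟦ S ⟧ × (∀ {q} → q ∈ ⟦ S ⟧ → ¬ f q ≺ f p)
  go p p∈ (acc rs) with any? (λ i → any? (λ j → T? (S (i , j)) ×-dec f (i , j) ≺? f p))
  ... | yes (i , j , q∈ , q≺p) = go (i , j) q∈ (rs q≺p)
  ... | no ¬smaller            = p , p∈ , λ q∈ q≺p → ¬smaller (_ , _ , q∈ , q≺p)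

extremes : CellOf S → Extremes S
extremes {S = S} u
  with (_ , topmost , top≤)       ← minimal {S = S} <-wellFounded _<?_ proj₁ u
     | (_ , bottommost , ≤bottom) ← minimal {S = S} >-wellFounded (flip _<?_) proj₁ u
     | (_ , leftmost , left≤)     ← minimal {S = S} <-wellFounded _<?_ proj₂ u
     | (_ , rightmost , ≤right)   ← minimal {S = S} >-wellFounded (flip _<?_) proj₂ u
  = record
  { topmost    = topmost    ; top≤    = λ q∈ → ℕ.≮⇒≥ (top≤ q∈)
  ; bottommost = bottommost ; ≤bottom = λ q∈ → ℕ.≮⇒≥ (≤bottom q∈)
  ; leftmost   = leftmost   ; left≤   = λ q∈ → ℕ.≮⇒≥ (left≤ q∈)
  ; rightmost  = rightmost  ; ≤right  = λ q∈ → ℕ.≮⇒≥ (≤right q∈)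
  }

CornerSets : (S : CellSet m n) → CellSet m n → CellSet m n → CellSet m n → CellSet m n → Set
CornerSets {m} {n} S A B C D =
  UpperLeft {m} {n} A × UpperRight {m} {n} B × LowerLeft {m} {n} C × LowerRight {m} {n} D
  × ∁ ⟦ S ⟧ ≐ ⟦ A ⟧ ∪ ⟦ B ⟧ ∪ ⟦ C ⟧ ∪ ⟦ D ⟧
  × (⟦ A ⟧ ⊥ ⟦ B ⟧) × (⟦ A ⟧ ⊥ ⟦ C ⟧) × (⟦ A ⟧ ⊥ ⟦ D ⟧)
  × (⟦ B ⟧ ⊥ ⟦ C ⟧) × (⟦ B ⟧ ⊥ ⟦ D ⟧) × (⟦ C ⟧ ⊥ ⟦ D ⟧)
  × ((i⁻ i : Fin m) (j⁻ j : Fin n) → i⁻ ⋖ i → j⁻ ⋖ j →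
       (i⁻ , j⁻) ∈ ⟦ A ⟧ → (i , j) ∉ ⟦ D ⟧)
  × ((i⁻ i : Fin m) (j j⁺ : Fin n) → i⁻ ⋖ i → j ⋖ j⁺ →
       (i⁻ , j⁺) ∈ ⟦ B ⟧ → (i , j) ∉ ⟦ C ⟧)

⋖⇒≤ : {i i′ : Fin n} → i ⋖ i′ → i Fin.≤ i′
⋖⇒≤ e = ℕ.≤-trans (ℕ.n≤1+n _) (ℕ.≤-reflexive (sym e))

module Pinwheel {m n : ℕ} {S : CellSet m n} (E : Extremes S) where
  open Extremes E

  A B C D : Pred (Cell m n) 0ℓ
  A (i , j) = (i Fin.≤ l × j Fin.< t) × ¬ Meets S Fin._≤_ Fin._≤_ (i , j)
  B (i , j) = (i Fin.< r × t Fin.≤ j) × ¬ Meets S Fin._≤_ Fin._≥_ (i , j)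
  C (i , j) = (l Fin.< i × j Fin.≤ b) × ¬ Meets S Fin._≥_ Fin._≤_ (i , j)
  D (i , j) = (r Fin.≤ i × b Fin.< j) × ¬ Meets S Fin._≥_ Fin._≥_ (i , j)

  A? : Decidable A
  A? (i , j) = (i ≤? l ×-dec j <? t) ×-dec ¬? (meets? S _≤?_ _≤?_ (i , j))

  B? : Decidable B
  B? (i , j) = (i <? r ×-dec t ≤? j) ×-dec ¬? (meets? S _≤?_ (flip _≤?_) (i , j))

  C? : Decidable C
  C? (i , j) = (l <? i ×-dec j ≤? b) ×-dec ¬? (meets? S (flip _≤?_) _≤?_ (i , j))

  D? : Decidable D
  D? (i , j) = (r ≤? i ×-dec b <? j) ×-dec ¬? (meets? S (flip _≤?_) (flip _≤?_) (i , j))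

  A-closed : ∀ {i i′ j j′} → i Fin.≤ i′ → j Fin.≤ j′ → A (i′ , j′) → A (i , j)
  A-closed i≤ j≤ ((i≤l , j<t) , free) =
    (ℕ.≤-trans i≤ i≤l , ℕ.≤-<-trans j≤ j<t) ,
    λ (a , b , ab∈ , a≤ , b≤) → free (a , b , ab∈ , ℕ.≤-trans a≤ i≤ , ℕ.≤-trans b≤ j≤)

  B-closed : ∀ {i i′ j j′} → i Fin.≤ i′ → j Fin.≤ j′ → B (i′ , j) → B (i , j′)
  B-closed i≤ j≤ ((i<r , t≤j) , free) =
    (ℕ.≤-<-trans i≤ i<r , ℕ.≤-trans t≤j j≤) ,
    λ (a , b , ab∈ , a≤ , ≤b) → free (a , b , ab∈ , ℕ.≤-trans a≤ i≤ , ℕ.≤-trans j≤ ≤b)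

  C-closed : ∀ {i i′ j j′} → i Fin.≤ i′ → j Fin.≤ j′ → C (i , j′) → C (i′ , j)
  C-closed i≤ j≤ ((l<i , j≤b) , free) =
    (ℕ.<-≤-trans l<i i≤ , ℕ.≤-trans j≤ j≤b) ,
    λ (a , b , ab∈ , ≤a , b≤) → free (a , b , ab∈ , ℕ.≤-trans i≤ ≤a , ℕ.≤-trans b≤ j≤)

  D-closed : ∀ {i i′ j j′} → i Fin.≤ i′ → j Fin.≤ j′ → D (i , j) → D (i′ , j′)
  D-closed i≤ j≤ ((r≤i , b<j) , free) =
    (ℕ.≤-trans r≤i i≤ , ℕ.<-≤-trans b<j j≤) ,
    λ (a , b , ab∈ , ≤a , ≤b) → free (a , b , ab∈ , ℕ.≤-trans i≤ ≤a , ℕ.≤-trans j≤ ≤b)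

  module _ (conn : Polyomino S) (hv : HVConvex S) where

    -- Two free opposite quadrants this close leave only a part of S above and
    -- to the right and a part below and to the left, with no path between them.
    -- Taking (i₂ , j₂) to be (i₁ , j₁) gives disjointness, and taking it to be
    -- (i₁ + 1 , j₁ + 1) gives condition (i).
    A-D-apart : ∀ {i₁ i₂ j₁ j₂} → toℕ i₂ ≤ ℕ.suc (toℕ i₁) → toℕ j₂ ≤ ℕ.suc (toℕ j₁) →
      A (i₁ , j₁) → ¬ D (i₂ , j₂)
    A-D-apart {i₁} {i₂} {j₁} {j₂} i₂≤ j₂≤ ((_ , j₁<t) , freeA) ((_ , b<j₂) , freeD) =
      ℕ.<⇒≱ b<j₂ (ℕ.≤-trans j₂≤ (above⇒right bottommost
        (row-invariant (Fin._≤ i₁) (j₁ Fin.<_) conn above⇒right right⇒above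
          topmost bottommost (right⇒above topmost j₁<t))))
      where
      above⇒right : ∀ {i j} → (i , j) ∈ ⟦ S ⟧ → i Fin.≤ i₁ → j₁ Fin.< j
      above⇒right p∈ i≤i₁ = ℕ.≰⇒> λ j≤j₁ → freeA (_ , _ , p∈ , i≤i₁ , j≤j₁)

      right⇒above : ∀ {i j} → (i , j) ∈ ⟦ S ⟧ → j₁ Fin.< j → i Fin.≤ i₁
      right⇒above p∈ j₁<j = s≤s⁻¹ (ℕ.<-≤-trans
        (ℕ.≰⇒> λ i₂≤i → freeD (_ , _ , p∈ , i₂≤i , ℕ.≤-trans j₂≤ j₁<j)) i₂≤)

    B-C-apart : ∀ {i₁ i₂ j₁ j₂} → toℕ i₂ ≤ ℕ.suc (toℕ i₁) → toℕ j₁ ≤ ℕ.suc (toℕ j₂) →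
      B (i₁ , j₁) → ¬ C (i₂ , j₂)
    B-C-apart {i₁} {i₂} {j₁} {j₂} i₂≤ j₁≤ ((i₁<r , _) , freeB) ((l<i₂ , _) , freeC) =
      ℕ.<⇒≱ l<i₂ (ℕ.≤-trans i₂≤
        (row-invariant (i₁ Fin.<_) (j₁ Fin.≤_) conn below⇒right right⇒below
          rightmost leftmost i₁<r))
      where
      below⇒right : ∀ {i j} → (i , j) ∈ ⟦ S ⟧ → i₁ Fin.< i → j₁ Fin.≤ j
      below⇒right p∈ i₁<i = ℕ.≤-trans j₁≤
        (ℕ.≰⇒> λ j≤j₂ → freeC (_ , _ , p∈ , ℕ.≤-trans i₂≤ i₁<i , j≤j₂))

      right⇒below : ∀ {i j} → (i , j) ∈ ⟦ S ⟧ → j₁ Fin.≤ j → i₁ Fin.< i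
      right⇒below p∈ j₁≤j = ℕ.≰⇒> λ i≤i₁ → freeB (_ , _ , p∈ , i≤i₁ , j₁≤j)

    above-free : (C : Rel (Fin n) 0ℓ) → ∀ {i j} → i Fin.< top → ¬ Meets S Fin._≤_ C (i , j)
    above-free _ i<top (_ , _ , q∈ , a≤i , _) = ℕ.<⇒≱ i<top (ℕ.≤-trans (top≤ q∈) a≤i)

    below-free : (C : Rel (Fin n) 0ℓ) → ∀ {i j} → bottom Fin.< i → ¬ Meets S Fin._≥_ C (i , j)
    below-free _ bottom<i (_ , _ , q∈ , i≤a , _) = ℕ.<⇒≱ bottom<i (ℕ.≤-trans i≤a (≤bottom q∈))

    left-free : (R : Rel (Fin m) 0ℓ) → ∀ {i j} → j Fin.< left → ¬ Meets S R Fin._≤_ (i , j)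
    left-free _ j<left (_ , _ , q∈ , _ , b≤j) = ℕ.<⇒≱ j<left (ℕ.≤-trans (left≤ q∈) b≤j)

    right-free : (R : Rel (Fin m) 0ℓ) → ∀ {i j} → right Fin.< j → ¬ Meets S R Fin._≥_ (i , j)
    right-free _ right<j (_ , _ , q∈ , _ , j≤b) = ℕ.<⇒≱ right<j (ℕ.≤-trans j≤b (≤right q∈))

    cover : ∀ {p} → p ∉ ⟦ S ⟧ → (A ∪ B ∪ C ∪ D) p
    cover {i , j} p∉ with i <? top
    ... | yes i<top with j <? t
    ...   | yes j<t =
            inj₁ ((ℕ.<⇒≤ (ℕ.<-≤-trans i<top (top≤ leftmost)) , j<t) , above-free Fin._≤_ i<top)
    ...   | no j≮t =
            inj₂ (inj₁ ((ℕ.<-≤-trans i<top (top≤ rightmost) , ℕ.≮⇒≥ j≮t) , above-free Fin._≥_ i<top))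
    cover {i , j} p∉ | no i≮top with bottom <? i
    ... | yes bottom<i with j ≤? b
    ...   | yes j≤b =
            inj₂ (inj₂ (inj₁ ((ℕ.≤-<-trans (≤bottom leftmost) bottom<i , j≤b) ,
                              below-free Fin._≤_ bottom<i)))
    ...   | no j≰b =
            inj₂ (inj₂ (inj₂ ((ℕ.<⇒≤ (ℕ.≤-<-trans (≤bottom rightmost) bottom<i) , ℕ.≰⇒> j≰b) ,
                              below-free Fin._≥_ bottom<i)))
    cover {i , j} p∉ | no i≮top | no bottom≮i with j <? left
    ... | yes j<left with i ≤? l
    ...   | yes i≤l =
            inj₁ ((i≤l , ℕ.<-≤-trans j<left (left≤ topmost)) , left-free Fin._≤_ j<left)
    ...   | no i≰l =
            inj₂ (inj₂ (inj₁ ((ℕ.≰⇒> i≰l , ℕ.<⇒≤ (ℕ.<-≤-trans j<left (left≤ bottommost))) ,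
                              left-free Fin._≥_ j<left)))
    cover {i , j} p∉ | no i≮top | no bottom≮i | no j≮left with right <? j
    ... | yes right<j with i <? r
    ...   | yes i<r =
            inj₂ (inj₁ ((i<r , ℕ.<⇒≤ (ℕ.≤-<-trans (≤right topmost) right<j)) ,
                        right-free Fin._≤_ right<j))
    ...   | no i≮r =
            inj₂ (inj₂ (inj₂ ((ℕ.≮⇒≥ i≮r , ℕ.≤-<-trans (≤right bottommost) right<j) ,
                              right-free Fin._≥_ right<j)))
    cover {i , j} p∉ | no i≮top | no bottom≮i | no j≮left | no right≮j
      with meets? S _≤?_ _≤?_ (i , j)        | meets? S _≤?_ (flip _≤?_) (i , j)
         | meets? S (flip _≤?_) _≤?_ (i , j) | meets? S (flip _≤?_) (flip _≤?_) (i , j)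
    ... | no ¬a | _ | _ | _ =
          inj₁ (( ℕ.≰⇒≥ (λ l≤i → ¬a (_ , _ , leftmost , l≤i , ℕ.≮⇒≥ j≮left))
                , ℕ.≰⇒> (λ t≤j → ¬a (_ , _ , topmost , ℕ.≮⇒≥ i≮top , t≤j))) , ¬a)
    ... | _ | no ¬b | _ | _ =
          inj₂ (inj₁ (( ℕ.≰⇒> (λ r≤i → ¬b (_ , _ , rightmost , r≤i , ℕ.≮⇒≥ right≮j))
                      , ℕ.≰⇒≥ (λ j≤t → ¬b (_ , _ , topmost , ℕ.≮⇒≥ i≮top , j≤t))) , ¬b))
    ... | _ | _ | no ¬c | _ =
          inj₂ (inj₂ (inj₁
            (( ℕ.≰⇒> (λ i≤l → ¬c (_ , _ , leftmost , i≤l , ℕ.≮⇒≥ j≮left))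
             , ℕ.≰⇒≥ (λ b≤j → ¬c (_ , _ , bottommost , ℕ.≮⇒≥ bottom≮i , b≤j))) , ¬c)))
    ... | _ | _ | _ | no ¬d =
          inj₂ (inj₂ (inj₂
            (( ℕ.≰⇒≥ (λ i≤r → ¬d (_ , _ , rightmost , i≤r , ℕ.≮⇒≥ right≮j))
             , ℕ.≰⇒> (λ j≤b → ¬d (_ , _ , bottommost , ℕ.≮⇒≥ bottom≮i , j≤b))) , ¬d)))
    ... | yes a | yes b | yes c | yes d = contradiction d (free-quadrant conn hv p∉ a b c)

    A⇒∁ : ∀ {p} → A p → p ∉ ⟦ S ⟧
    A⇒∁ (_ , free) p∈ = free (_ , _ , p∈ , ℕ.≤-refl , ℕ.≤-refl)

    B⇒∁ : ∀ {p} → B p → p ∉ ⟦ S ⟧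
    B⇒∁ (_ , free) p∈ = free (_ , _ , p∈ , ℕ.≤-refl , ℕ.≤-refl)

    C⇒∁ : ∀ {p} → C p → p ∉ ⟦ S ⟧
    C⇒∁ (_ , free) p∈ = free (_ , _ , p∈ , ℕ.≤-refl , ℕ.≤-refl)

    D⇒∁ : ∀ {p} → D p → p ∉ ⟦ S ⟧
    D⇒∁ (_ , free) p∈ = free (_ , _ , p∈ , ℕ.≤-refl , ℕ.≤-refl)

    cornerSets : CornerSets S (⌊_⌋ ∘ A?) (⌊_⌋ ∘ B?) (⌊_⌋ ∘ C?) (⌊_⌋ ∘ D?)
    cornerSets =
        (λ _ → [ (λ (_ , e , q) → fromWitness (A-closed (⋖⇒≤ e) ℕ.≤-refl (toWitness q)))
               , (λ (_ , e , q) → fromWitness (A-closed ℕ.≤-refl (⋖⇒≤ e) (toWitness q))) ]′)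
      , (λ _ → [ (λ (_ , e , q) → fromWitness (B-closed (⋖⇒≤ e) ℕ.≤-refl (toWitness q)))
               , (λ (_ , e , q) → fromWitness (B-closed ℕ.≤-refl (⋖⇒≤ e) (toWitness q))) ]′)
      , (λ _ → [ (λ (_ , e , q) → fromWitness (C-closed (⋖⇒≤ e) ℕ.≤-refl (toWitness q)))
               , (λ (_ , e , q) → fromWitness (C-closed ℕ.≤-refl (⋖⇒≤ e) (toWitness q))) ]′)
      , (λ _ → [ (λ (_ , e , q) → fromWitness (D-closed (⋖⇒≤ e) ℕ.≤-refl (toWitness q)))
               , (λ (_ , e , q) → fromWitness (D-closed ℕ.≤-refl (⋖⇒≤ e) (toWitness q))) ]′)
      , ( Sum.map fromWitness (Sum.map fromWitness (Sum.map fromWitness fromWitness)) ∘ cover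
        , [ A⇒∁ ∘ toWitness , [ B⇒∁ ∘ toWitness , [ C⇒∁ ∘ toWitness , D⇒∁ ∘ toWitness ]′ ]′ ]′)
      , (λ (a , b) → A⊥B (toWitness a) (toWitness b))
      , (λ (a , c) → A⊥C (toWitness a) (toWitness c))
      , (λ (a , d) → A-D-apart (ℕ.n≤1+n _) (ℕ.n≤1+n _) (toWitness a) (toWitness d))
      , (λ (b , c) → B-C-apart (ℕ.n≤1+n _) (ℕ.n≤1+n _) (toWitness b) (toWitness c))
      , (λ (b , d) → B⊥D (toWitness b) (toWitness d))
      , (λ (c , d) → C⊥D (toWitness c) (toWitness d))
      , (λ _ _ _ _ eᵢ eⱼ a d →
           A-D-apart (ℕ.≤-reflexive eᵢ) (ℕ.≤-reflexive eⱼ) (toWitness a) (toWitness d))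
      , (λ _ _ _ _ eᵢ eⱼ b c →
           B-C-apart (ℕ.≤-reflexive eᵢ) (ℕ.≤-reflexive eⱼ) (toWitness b) (toWitness c))
      where
      A⊥B : ∀ {p} → A p → ¬ B p
      A⊥B ((_ , j<t) , _) ((_ , t≤j) , _) = ℕ.<⇒≱ j<t t≤j

      A⊥C : ∀ {p} → A p → ¬ C p
      A⊥C ((i≤l , _) , _) ((l<i , _) , _) = ℕ.<⇒≱ l<i i≤l

      B⊥D : ∀ {p} → B p → ¬ D p
      B⊥D ((i<r , _) , _) ((r≤i , _) , _) = ℕ.<⇒≱ i<r r≤i

      C⊥D : ∀ {p} → C p → ¬ D p
      C⊥D ((_ , j≤b) , _) ((_ , b<j) , _) = ℕ.<⇒≱ b<j j≤b

empty-cornerSets : (S : CellSet m n) → ¬ CellOf S →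
  CornerSets S (λ _ → true) (λ _ → false) (λ _ → false) (λ _ → false)
empty-cornerSets S empty =
    (λ _ _ → tt)
  , (λ _ → [ proj₂ ∘ proj₂ , proj₂ ∘ proj₂ ]′)
  , (λ _ → [ proj₂ ∘ proj₂ , proj₂ ∘ proj₂ ]′)
  , (λ _ → [ proj₂ ∘ proj₂ , proj₂ ∘ proj₂ ]′)
  , ((λ _ → inj₁ tt) , λ _ p∈ → empty (_ , p∈))
  , proj₂ , proj₂ , proj₂ , proj₁ , proj₁ , proj₁
  , (λ _ _ _ _ _ _ _ ()) , λ _ _ _ _ _ _ ()

hv-polyomino⇒cornerSets : (S : CellSet m n) → Polyomino S × HVConvex S →
  ∃[ A ] ∃[ B ] ∃[ C ] ∃[ D ] CornerSets S A B C D
hv-polyomino⇒cornerSets S (conn , hv) with any? (λ i → any? (λ j → T? (S (i , j))))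
... | yes (i , j , p∈) = _ , _ , _ , _ , Pinwheel.cornerSets (extremes ((i , j) , p∈)) conn hv
... | no empty = _ , _ , _ , _ , empty-cornerSets S λ ((i , j) , p∈) → empty (i , j , p∈)

≤⇒chain : {i i′ : Fin n} → i Fin.≤ i′ → Star _⋖_ i i′
≤⇒chain {i = zero}  {zero}         _          = ε
≤⇒chain {i = zero}  {suc zero}     _          = refl ◅ ε
≤⇒chain {i = zero}  {suc (suc i′)} _          =
  refl ◅ gmap suc (cong ℕ.suc) (≤⇒chain {i = zero} {suc i′} z≤n)
≤⇒chain {i = suc i} {suc i′}       (s≤s i≤i′) = gmap suc (cong ℕ.suc) (≤⇒chain i≤i′)

chain⇒≤ : {i i′ : Fin n} → Star _⋖_ i i′ → i Fin.≤ i′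
chain⇒≤ = fold Fin._≤_ (λ e → ℕ.≤-trans (⋖⇒≤ e)) ℕ.≤-refl

backward : (P : Pred (Fin n) 0ℓ) → (∀ {i i′} → i ⋖ i′ → P i′ → P i) →
  ∀ {i i′} → i Fin.≤ i′ → P i′ → P i
backward P step i≤i′ = fold (λ i i′ → P i′ → P i) (λ e k → step e ∘ k) id (≤⇒chain i≤i′)

forward : (P : Pred (Fin n) 0ℓ) → (∀ {i i′} → i ⋖ i′ → P i → P i′) →
  ∀ {i i′} → i Fin.≤ i′ → P i → P i′
forward P step i≤i′ = fold (λ i i′ → P i → P i′) (λ e k → k ∘ step e) id (≤⇒chain i≤i′)

upperLeft-closed : (A : CellSet m n) → UpperLeft A → ∀ {i i′ j j′} → i Fin.≤ i′ → j Fin.≤ j′ →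
  (i′ , j′) ∈ ⟦ A ⟧ → (i , j) ∈ ⟦ A ⟧
upperLeft-closed A ul {i} {j′ = j′} i≤ j≤ =
  backward (λ j → (i , j) ∈ ⟦ A ⟧) (λ e q → ul _ (inj₂ (_ , e , q))) j≤ ∘
  backward (λ i → (i , j′) ∈ ⟦ A ⟧) (λ e q → ul _ (inj₁ (_ , e , q))) i≤

upperRight-closed : (B : CellSet m n) → UpperRight B → ∀ {i i′ j j′} → i Fin.≤ i′ → j Fin.≤ j′ →
  (i′ , j) ∈ ⟦ B ⟧ → (i , j′) ∈ ⟦ B ⟧
upperRight-closed B ur {i} {j = j} i≤ j≤ =
  forward (λ j → (i , j) ∈ ⟦ B ⟧) (λ e q → ur _ (inj₂ (_ , e , q))) j≤ ∘
  backward (λ i → (i , j) ∈ ⟦ B ⟧) (λ e q → ur _ (inj₁ (_ , e , q))) i≤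

lowerLeft-closed : (C : CellSet m n) → LowerLeft C → ∀ {i i′ j j′} → i Fin.≤ i′ → j Fin.≤ j′ →
  (i , j′) ∈ ⟦ C ⟧ → (i′ , j) ∈ ⟦ C ⟧
lowerLeft-closed C ll {i′ = i′} {j′ = j′} i≤ j≤ =
  backward (λ j → (i′ , j) ∈ ⟦ C ⟧) (λ e q → ll _ (inj₂ (_ , e , q))) j≤ ∘
  forward (λ i → (i , j′) ∈ ⟦ C ⟧) (λ e q → ll _ (inj₁ (_ , e , q))) i≤

lowerRight-closed : (D : CellSet m n) → LowerRight D → ∀ {i i′ j j′} → i Fin.≤ i′ → j Fin.≤ j′ →
  (i , j) ∈ ⟦ D ⟧ → (i′ , j′) ∈ ⟦ D ⟧
lowerRight-closed D lr {i′ = i′} {j} i≤ j≤ =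
  forward (λ j → (i′ , j) ∈ ⟦ D ⟧) (λ e q → lr _ (inj₂ (_ , e , q))) j≤ ∘
  forward (λ i → (i , j) ∈ ⟦ D ⟧) (λ e q → lr _ (inj₁ (_ , e , q))) i≤

Path : (S : CellSet m n) → Rel (CellOf S) 0ℓ
Path S = Star (Adjacent on proj₁)

staircase : (S : CellSet m n) {N : Rel (Fin n) 0ℓ} →
  (∀ {i j j′} → N j j′ → Adjacent {m} (i , j) (i , j′)) →
  (∀ {i k j l} → N k j → Star N j l → (i , k) ∈ ⟦ S ⟧ → (i , l) ∈ ⟦ S ⟧ → (i , j) ∈ ⟦ S ⟧) →
  (∀ {k i l j} → k ⋖ i → Star _⋖_ i l → (k , j) ∈ ⟦ S ⟧ → (l , j) ∈ ⟦ S ⟧ → (i , j) ∈ ⟦ S ⟧) →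
  (∀ {i i′ k j j′ l} → i ⋖ i′ → Star _⋖_ i′ k → N j j′ → Star N j′ l →
     (i , j) ∈ ⟦ S ⟧ → (k , l) ∈ ⟦ S ⟧ → (i′ , j) ∈ ⟦ S ⟧ ⊎ (i , j′) ∈ ⟦ S ⟧) →
  ∀ {i j k l} → Star _⋖_ i k → Star N j l →
  (p∈ : (i , j) ∈ ⟦ S ⟧) (q∈ : (k , l) ∈ ⟦ S ⟧) →
  Path S ((i , j) , p∈) ((k , l) , q∈)
staircase {m} S {N} adj hconv vconv corner = go
  where
  go : ∀ {i j k l} → Star _⋖_ i k → Star N j l →
    (p∈ : (i , j) ∈ ⟦ S ⟧) (q∈ : (k , l) ∈ ⟦ S ⟧) →
    Path S ((i , j) , p∈) ((k , l) , q∈)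
  go {i} {j} ε ε p∈ q∈ = loop (i , j) ◅ ε
  go {i} ε (e ◅ es) p∈ q∈ = adj {i} e ◅ go ε es (hconv e es p∈ q∈) q∈
  go {j = j} (d ◅ ds) ε p∈ q∈ = vertical-adjacent {j = j} d ◅ go ds ε (vconv d ds p∈ q∈) q∈
  go {i} {j} (d ◅ ds) (e ◅ es) p∈ q∈ =
    [ (λ down∈ → vertical-adjacent {j = j} d ◅ go ds (e ◅ es) down∈ q∈)
    , (λ side∈ → adj {i} e ◅ go (d ◅ ds) es side∈ q∈)
    ]′ (corner d ds e es p∈ q∈)

cornerSets⇒hv-polyomino : (S A B C D : CellSet m n) → CornerSets S A B C D →
  Polyomino S × HVConvex S
cornerSets⇒hv-polyomino {m} {n} S A B C D
  (ul , ur , ll , lr , (∁⊆ , ∁⊇) , _ , _ , _ , _ , _ , _ , A-D-apart , B-C-apart) =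
  connected , (λ i k j l → hconv {i} {k} {j} {l}) , (λ k i l j → vconv {k} {i} {l} {j})
  where
  A⇒∁ : ∀ {p} → p ∈ ⟦ A ⟧ → p ∉ ⟦ S ⟧
  A⇒∁ = ∁⊇ ∘ inj₁

  B⇒∁ : ∀ {p} → p ∈ ⟦ B ⟧ → p ∉ ⟦ S ⟧
  B⇒∁ = ∁⊇ ∘ inj₂ ∘ inj₁

  C⇒∁ : ∀ {p} → p ∈ ⟦ C ⟧ → p ∉ ⟦ S ⟧
  C⇒∁ = ∁⊇ ∘ inj₂ ∘ inj₂ ∘ inj₁

  D⇒∁ : ∀ {p} → p ∈ ⟦ D ⟧ → p ∉ ⟦ S ⟧
  D⇒∁ = ∁⊇ ∘ inj₂ ∘ inj₂ ∘ inj₂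

  hconv : ∀ {i k j l} → (i , k) ∈ ⟦ S ⟧ → (i , l) ∈ ⟦ S ⟧ → k Fin.≤ j → j Fin.≤ l → (i , j) ∈ ⟦ S ⟧
  hconv {i} {k} {j} {l} k∈ l∈ k≤j j≤l = decidable-stable (T? (S (i , j))) λ j∉ → case ∁⊆ j∉ of λ
    { (inj₁ a)               → A⇒∁ (upperLeft-closed A ul (≤-refl {x = i}) k≤j a) k∈
    ; (inj₂ (inj₁ b))        → B⇒∁ (upperRight-closed B ur (≤-refl {x = i}) j≤l b) l∈
    ; (inj₂ (inj₂ (inj₁ c))) → C⇒∁ (lowerLeft-closed C ll (≤-refl {x = i}) k≤j c) k∈
    ; (inj₂ (inj₂ (inj₂ d))) → D⇒∁ (lowerRight-closed D lr (≤-refl {x = i}) j≤l d) l∈ }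

  vconv : ∀ {k i l j} → (k , j) ∈ ⟦ S ⟧ → (l , j) ∈ ⟦ S ⟧ → k Fin.≤ i → i Fin.≤ l → (i , j) ∈ ⟦ S ⟧
  vconv {k} {i} {l} {j} k∈ l∈ k≤i i≤l = decidable-stable (T? (S (i , j))) λ i∉ → case ∁⊆ i∉ of λ
    { (inj₁ a)               → A⇒∁ (upperLeft-closed A ul k≤i (≤-refl {x = j}) a) k∈
    ; (inj₂ (inj₁ b))        → B⇒∁ (upperRight-closed B ur k≤i (≤-refl {x = j}) b) k∈
    ; (inj₂ (inj₂ (inj₁ c))) → C⇒∁ (lowerLeft-closed C ll i≤l (≤-refl {x = j}) c) l∈
    ; (inj₂ (inj₂ (inj₂ d))) → D⇒∁ (lowerRight-closed D lr i≤l (≤-refl {x = j}) d) l∈ }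

  corner-right : ∀ {i i′ k j j′ l} → i ⋖ i′ → i′ Fin.≤ k → j ⋖ j′ → j′ Fin.≤ l →
    (i , j) ∈ ⟦ S ⟧ → (k , l) ∈ ⟦ S ⟧ → (i′ , j) ∈ ⟦ S ⟧ ⊎ (i , j′) ∈ ⟦ S ⟧
  corner-right {i} {i′} {k} {j} {j′} {l} d i′≤k e j′≤l p∈ q∈
    with T? (S (i′ , j)) | T? (S (i , j′))
  ... | yes down∈ | _          = inj₁ down∈
  ... | no _      | yes right∈ = inj₂ right∈
  ... | no down∉  | no right∉  =
      contradiction (down∈C (∁⊆ down∉)) (B-C-apart _ _ _ _ d e (right∈B (∁⊆ right∉)))
    where
    i≤k = ≤-trans (⋖⇒≤ d) i′≤k
    j≤l = ≤-trans (⋖⇒≤ e) j′≤l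

    down∈C : (⟦ A ⟧ ∪ ⟦ B ⟧ ∪ ⟦ C ⟧ ∪ ⟦ D ⟧) (i′ , j) → (i′ , j) ∈ ⟦ C ⟧
    down∈C (inj₁ a)               = contradiction p∈ (A⇒∁ (ul _ (inj₁ (_ , d , a))))
    down∈C (inj₂ (inj₁ b))        = contradiction p∈ (B⇒∁ (ur _ (inj₁ (_ , d , b))))
    down∈C (inj₂ (inj₂ (inj₁ c))) = c
    down∈C (inj₂ (inj₂ (inj₂ x))) = contradiction q∈ (D⇒∁ (lowerRight-closed D lr i′≤k j≤l x))

    right∈B : (⟦ A ⟧ ∪ ⟦ B ⟧ ∪ ⟦ C ⟧ ∪ ⟦ D ⟧) (i , j′) → (i , j′) ∈ ⟦ B ⟧
    right∈B (inj₁ a)               = contradiction p∈ (A⇒∁ (ul _ (inj₂ (_ , e , a))))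
    right∈B (inj₂ (inj₁ b))        = b
    right∈B (inj₂ (inj₂ (inj₁ c))) = contradiction p∈ (C⇒∁ (ll _ (inj₂ (_ , e , c))))
    right∈B (inj₂ (inj₂ (inj₂ x))) = contradiction q∈ (D⇒∁ (lowerRight-closed D lr i≤k j′≤l x))

  corner-left : ∀ {i i′ k j j′ l} → i ⋖ i′ → i′ Fin.≤ k → j′ ⋖ j → l Fin.≤ j′ →
    (i , j) ∈ ⟦ S ⟧ → (k , l) ∈ ⟦ S ⟧ → (i′ , j) ∈ ⟦ S ⟧ ⊎ (i , j′) ∈ ⟦ S ⟧
  corner-left {i} {i′} {k} {j} {j′} {l} d i′≤k e l≤j′ p∈ q∈
    with T? (S (i′ , j)) | T? (S (i , j′))
  ... | yes down∈ | _         = inj₁ down∈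
  ... | no _      | yes left∈ = inj₂ left∈
  ... | no down∉  | no left∉  =
      contradiction (down∈D (∁⊆ down∉)) (A-D-apart _ _ _ _ d e (left∈A (∁⊆ left∉)))
    where
    i≤k = ≤-trans (⋖⇒≤ d) i′≤k
    l≤j = ≤-trans l≤j′ (⋖⇒≤ e)

    down∈D : (⟦ A ⟧ ∪ ⟦ B ⟧ ∪ ⟦ C ⟧ ∪ ⟦ D ⟧) (i′ , j) → (i′ , j) ∈ ⟦ D ⟧
    down∈D (inj₁ a)               = contradiction p∈ (A⇒∁ (ul _ (inj₁ (_ , d , a))))
    down∈D (inj₂ (inj₁ b))        = contradiction p∈ (B⇒∁ (ur _ (inj₁ (_ , d , b))))
    down∈D (inj₂ (inj₂ (inj₁ c))) = contradiction q∈ (C⇒∁ (lowerLeft-closed C ll i′≤k l≤j c))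
    down∈D (inj₂ (inj₂ (inj₂ x))) = x

    left∈A : (⟦ A ⟧ ∪ ⟦ B ⟧ ∪ ⟦ C ⟧ ∪ ⟦ D ⟧) (i , j′) → (i , j′) ∈ ⟦ A ⟧
    left∈A (inj₁ a)               = a
    left∈A (inj₂ (inj₁ b))        = contradiction p∈ (B⇒∁ (ur _ (inj₂ (_ , e , b))))
    left∈A (inj₂ (inj₂ (inj₁ c))) = contradiction q∈ (C⇒∁ (lowerLeft-closed C ll i≤k l≤j′ c))
    left∈A (inj₂ (inj₂ (inj₂ x))) = contradiction p∈ (D⇒∁ (lr _ (inj₂ (_ , e , x))))

  unflip : ∀ {j j′} → Star (flip _⋖_) j j′ → j′ Fin.≤ j
  unflip = chain⇒≤ ∘ reverse id

  path-down : ∀ {i j k l} → i Fin.≤ k → (p∈ : (i , j) ∈ ⟦ S ⟧) (q∈ : (k , l) ∈ ⟦ S ⟧) →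
    Path S ((i , j) , p∈) ((k , l) , q∈)
  path-down {i} {j} {k} {l} i≤k p∈ q∈ with ≤-total j l
  ... | inj₁ j≤l = staircase S (λ {i} → horizontal-adjacent {i = i})
          (λ e es k∈ l∈ → hconv k∈ l∈ (⋖⇒≤ e) (chain⇒≤ es))
          (λ d ds k∈ l∈ → vconv k∈ l∈ (⋖⇒≤ d) (chain⇒≤ ds))
          (λ d ds e es → corner-right d (chain⇒≤ ds) e (chain⇒≤ es))
          (≤⇒chain i≤k) (≤⇒chain j≤l) p∈ q∈
  ... | inj₂ l≤j = staircase S
          (λ {i} {j} {j′} e → adjacent-sym (i , j′) (i , j) (horizontal-adjacent {i = i} e))
          (λ e es k∈ l∈ → hconv l∈ k∈ (unflip es) (⋖⇒≤ e))
          (λ d ds k∈ l∈ → vconv k∈ l∈ (⋖⇒≤ d) (chain⇒≤ ds))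
          (λ d ds e es → corner-left d (chain⇒≤ ds) e (unflip es))
          (≤⇒chain i≤k) (reverse id (≤⇒chain l≤j)) p∈ q∈

  connected : Polyomino S
  connected ((i , j) , p∈) ((k , l) , q∈) with ≤-total i k
  ... | inj₁ i≤k = path-down i≤k p∈ q∈
  ... | inj₂ k≤i = reverse (λ {u} {v} → adjacent-sym (proj₁ u) (proj₁ v)) (path-down k≤i q∈ p∈)

lemma1 : (m n : ℕ) → 1 ≤ m → 1 ≤ n → (T : CellSet m n) →
    (Polyomino T × HVConvex T)
    ⇔
    (∃[ A ] ∃[ B ] ∃[ C ] ∃[ D ]
    UpperLeft {m} {n} A × UpperRight {m} {n} B × LowerLeft {m} {n} C × LowerRight {m} {n} D
    × ∁ ⟦ T ⟧ ≐ ⟦ A ⟧ ∪ ⟦ B ⟧ ∪ ⟦ C ⟧ ∪ ⟦ D ⟧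
    × (⟦ A ⟧ ⊥ ⟦ B ⟧) × (⟦ A ⟧ ⊥ ⟦ C ⟧) × (⟦ A ⟧ ⊥ ⟦ D ⟧)
    × (⟦ B ⟧ ⊥ ⟦ C ⟧) × (⟦ B ⟧ ⊥ ⟦ D ⟧) × (⟦ C ⟧ ⊥ ⟦ D ⟧)
    × ((i⁻ i : Fin m) (j⁻ j : Fin n) → i⁻ ⋖ i → j⁻ ⋖ j →
    (i⁻ , j⁻) ∈ ⟦ A ⟧ → (i , j) ∉ ⟦ D ⟧)
    × ((i⁻ i : Fin m) (j j⁺ : Fin n) → i⁻ ⋖ i → j ⋖ j⁺ →
    (i⁻ , j⁺) ∈ ⟦ B ⟧ → (i , j) ∉ ⟦ C ⟧))
lemma1 _ _ _ _ S = mk⇔ (hv-polyomino⇒cornerSets S)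
  λ (A , B , C , D , corners) → cornerSets⇒hv-polyomino S A B C D corners
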